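{- Let $v, e, r, c$ be positive integers with $r,c>1$, $ve=rc$ and $\max\{r,c\} < v \le \frac{rc}{2}$ (that is, a parameter set admissible for AO-arrays). Then there exist AO-arrays $S$ and $T$ such that the product construction (defined in the context) can be applied to $S$ and $T$, with suitable choices of the isotopic copies of $T$, so as to produce an $r\times c$ AO-array on $v$ symbols (with replication number $e$). In particular, an $r \times c$ AO-array on $v$ symbols exists for every admissible parameter set.
   Context: A row-column design is an array filled with symbols from a set of $v$ symbols such that no symbol occurs more than once in any row or in any column, and every symbol occurs exactly $e$ times in the array (replication number $e$). A $(v, e, -, -, \lambda_{rc} : r \times c)$ AO-array (adjusted orthogonal array) is an $r\times c$ row-column design on $v$ symbols with replication number $e$ in which every row and every column have exactly $\lambda_{rc}$ common symbols. The arrays $S$ and $T$ used as ingredients are allowed to be trivial (e.g. Latin rectangles, possibly with a single row or column). Two arrays are isotopic if one can be obtained from the other by permuting rows, permuting columns and renaming symbols by a bijection. Product construction: let $S$ be a $(v_S, e_S, -, -, \lambda_{rc}^S: r_S \times c_S)$ AO-array with symbols $s_1,\dots,s_{v_S}$, and let $T$ be a $(v_T, e_T, -, -, \lambda_{rc}^T: a \times b)$ AO-array. Take pairwise disjoint symbol sets $S_1,\dots,S_{v_S}$ with $|S_i|=v_T$ for all $i$. Replace each cell of $S$ containing symbol $s_i$ by an $a\times b$ AO-array isotopic to $T$ on the symbol set $S_i$, giving an $r_Sa\times c_Sb$ array on $v_Sv_T$ symbols. -}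

module Defs where

open import Data.Fin using (Fin; cast; combine; remQuot)
open import Data.Fin.Permutation using (Permutation′; _⟨$⟩ʳ_)
open import Data.Fin.Properties using (_≟_)
open import Data.Fin.Subset using (Subset; ⁅_⁆; ⋃; _∩_; ∣_∣)
open import Data.List using (allFin; cartesianProduct; filter; length; tabulate)
open import Data.Nat using (ℕ; _*_)
open import Data.Product using (Σ-syntax; _,_; uncurry)
open import Function.Definitions using (Injective)
open import Relation.Binary.PropositionalEquality using (_≡_)

Array : (r c v : ℕ) → Set
Array r c v = Fin r → Fin c → Fin v

private variable
  r c v : ℕ

occurrences : Array r c v → Fin v → ℕ
occurrences {r} {c} A s =
  length (filter (λ cell → uncurry A cell ≟ s) (cartesianProduct (allFin r) (allFin c)))

rowSymbols : Array r c v → Fin r → Subset v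
rowSymbols A i = ⋃ (tabulate (λ j → ⁅ A i j ⁆))

columnSymbols : Array r c v → Fin c → Subset v
columnSymbols A j = ⋃ (tabulate (λ i → ⁅ A i j ⁆))

record IsRowColumnDesign (e : ℕ) (A : Array r c v) : Set where
  field
    row-distinct    : ∀ i → Injective _≡_ _≡_ (λ j → A i j)
    column-distinct : ∀ j → Injective _≡_ _≡_ (λ i → A i j)
    replication     : ∀ s → occurrences A s ≡ e

record IsAOArray (e λrc : ℕ) (A : Array r c v) : Set where
  field
    isRowColumnDesign : IsRowColumnDesign e A
    adjusted          : ∀ i j → ∣ rowSymbols A i ∩ columnSymbols A j ∣ ≡ λrc

-- A (v, e, -, -, λrc : r × c) AO-array.
record AOArray (v e λrc r c : ℕ) : Set where
  field
    array     : Array r c v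
    isAOArray : IsAOArray e λrc array

Isotopic : Array r c v → Array r c v → Set
Isotopic {r} {c} {v} T U =
  Σ[ ρ ∈ Permutation′ r ] Σ[ κ ∈ Permutation′ c ] Σ[ σ ∈ Permutation′ v ]
    (∀ i j → U i j ≡ σ ⟨$⟩ʳ T (ρ ⟨$⟩ʳ i) (κ ⟨$⟩ʳ j))

private variable
  rS cS vS a b vT : ℕ

-- Replace cell (p , q) of S by the block U p q, carried to the symbol set
-- { combine (S p q) x ∣ x : Fin vT }.  These sets are pairwise disjoint of size
-- vT for distinct symbols of S, and together they exhaust Fin (vS * vT).
-- remQuot a i is the (block row , row within the block) of row i.
substitute : Array rS cS vS → (Fin rS → Fin cS → Array a b vT) →
             Array (rS * a) (cS * b) (vS * vT)
substitute {a = a} {b = b} S U i j =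
  let (p , i′) = remQuot a i
      (q , j′) = remQuot b j
  in combine (S p q) (U p q i′ j′)

-- A is a result of the product construction applied to S and T.  The isotopic
-- copy of T is chosen per cell of S, so two cells holding the same symbol may
-- receive different copies.
record IsProduct (S : Array rS cS vS) (T : Array a b vT) (A : Array r c v) : Set where
  field
    rows     : r ≡ rS * a
    columns  : c ≡ cS * b
    symbols  : v ≡ vS * vT
    copy     : Fin rS → Fin cS → Array a b vT
    isotopic : ∀ p q → Isotopic T (copy p q)
    agrees   : ∀ i j → cast symbols (A i j) ≡
                       substitute S copy (cast rows i) (cast columns j)

{-# OPTIONS --safe #-}
-- Put g = gcd(v, r), a = r / g and b = v / g.  Then b is coprime to a and divides
-- a c, so c = k b for some k; thus v = g b, r = g a, c = k b and e = k a.  The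
-- bounds r ≤ v and c ≤ v say exactly that a ≤ b and k ≤ g, so there are Latin
-- rectangles S of size g × k on g symbols and T of size a × b on b symbols.  Both
-- are AO-arrays, and using T itself as every copy multiplies the replication
-- numbers and the intersection numbers.
module Submission where

open import Data.Bool using (true; false)
open import Data.Fin using (Fin; suc; toℕ; combine; remQuot; inject≤)
open import Data.Fin.Permutation as Permutation using ()
open import Data.Fin.Properties
  using (_≟_; cast-is-id; combine-injective; combine-remQuot;
         inject≤-injective; nonZeroIndex; remQuot-combine; toℕ-fromℕ<; toℕ-injective;
         toℕ<n; toℕ≤n)
open import Data.Fin.Subset using (Subset; inside; outside; ⁅_⁆; ⋃; _∩_; ∣_∣)
  renaming (_∈_ to _∈ₛ_)
open import Data.Fin.Subset.Properties
  using (_∈?_; ∉⊥; ∩-comm; x∈p∩q⁺; x∈p∩q⁻; x∈p∪q⁺; x∈p∪q⁻; x∈⁅x⁆; x∈⁅y⁆⇒x≡y)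
open import Data.List
  using (List; []; _∷_; _++_; allFin; cartesianProduct; cartesianProductWith; filter;
         length; map; tabulate)
open import Data.List.Membership.Propositional using (_∈_)
open import Data.List.Membership.Propositional.Properties
  using (∈-allFin; ∈-cartesianProduct⁺; ∈-cartesianProductWith⁺; ∈-cartesianProductWith⁻;
         ∈-filter⁺; ∈-filter⁻; ∈-map⁺; ∈-map⁻; ∈-tabulate⁺; ∈-tabulate⁻)
open import Data.List.Membership.Propositional.Properties.WithK using (unique∧set⇒bag)
open import Data.List.Properties using (length-++; length-map; length-tabulate; map-tabulate)
open import Data.List.Relation.Binary.BagAndSetEquality using (∼bag⇒↭)
open import Data.List.Relation.Binary.Permutation.Propositional.Properties using (↭-length)
open import Data.List.Relation.Unary.Any using (here; there)
open import Data.List.Relation.Unary.Unique.Propositional using (Unique)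
open import Data.List.Relation.Unary.Unique.Propositional.Properties
  using (allFin⁺; cartesianProduct⁺; cartesianProductWith⁺; filter⁺; map⁺)
open import Data.Nat
  using (ℕ; NonZero; _+_; _*_; _∸_; _/_; _%_; _⊔_; _≤_; _<_; >-nonZero; ≢-nonZero; ≢-nonZero⁻¹)
open import Data.Nat.Coprimality using (coprime-/gcd; coprime-divisor)
open import Data.Nat.Divisibility using (_∣_; divides; quotient)
open import Data.Nat.DivMod
  using (_mod_; %-distribˡ-+; [m+n]%n≡m%n; m/n*n≡m; m%n%n≡m%n; m<n⇒m%n≡m)
open import Data.Nat.GCD using (gcd; gcd[m,n]∣m; gcd[m,n]∣n; gcd[m,n]≢0)
open import Data.Nat.Properties
  using (+-assoc; +-comm; *-assoc; *-cancelˡ-≡; *-cancelˡ-≤; *-cancelʳ-≤; *-comm;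
         m*n≢0⇒n≢0; m+[n∸m]≡n; m⊔n<o⇒m<o; m⊔n<o⇒n<o; <⇒≤)
open import Data.Product using (Σ-syntax; ∃-syntax; _×_; _,_; proj₁; proj₂; swap; uncurry)
open import Data.Sum using (inj₁; inj₂)
open import Data.Vec using ([]; _∷_)
open import Function using (_∘_; id; flip; it; _⇔_; mk⇔; Equivalence)
open import Function.Definitions using (Injective)
open import Relation.Binary.PropositionalEquality
  using (_≡_; refl; sym; trans; cong; cong₂; subst; subst₂; module ≡-Reasoning)
open import Relation.Nullary using (contradiction; does)
open import Defs

open Equivalence using (to; from)

private variable
  X Y Z : Set
  r c v rS cS vS rT cT vT : ℕ

-- Counting by enumeration

-- Duplicate-free lists with the same members are equal as bags, hence permutations of each other.
-- Every count below is reduced to this: the set in question is listed explicitly without repetition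
-- and the length of the list is read off.
length-cong-set : {xs ys : List X} → Unique xs → Unique ys →
                  (∀ {x} → x ∈ xs ⇔ x ∈ ys) → length xs ≡ length ys
length-cong-set uxs uys eq = ↭-length (∼bag⇒↭ (unique∧set⇒bag uxs uys eq))

length-cartesianProductWith : (f : X → Y → Z) (xs : List X) (ys : List Y) →
  length (cartesianProductWith f xs ys) ≡ length xs * length ys
length-cartesianProductWith f []       ys = refl
length-cartesianProductWith f (x ∷ xs) ys = begin
  length (map (f x) ys ++ cartesianProductWith f xs ys)           ≡⟨ length-++ (map (f x) ys) ⟩
  length (map (f x) ys) + length (cartesianProductWith f xs ys)
    ≡⟨ cong₂ _+_ (length-map (f x) ys) (length-cartesianProductWith f xs ys) ⟩
  length ys + length xs * length ys                               ∎
  where open ≡-Reasoning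

elements : Subset v → List (Fin v)
elements p = filter (_∈? p) (allFin _)

∈-elements : {p : Subset v} {x : Fin v} → x ∈ elements p ⇔ x ∈ₛ p
∈-elements {p = p} = mk⇔ (proj₂ ∘ ∈-filter⁻ (_∈? p) {xs = allFin _})
                         (∈-filter⁺ (_∈? p) (∈-allFin _))

elements-unique : (p : Subset v) → Unique (elements p)
elements-unique p = filter⁺ (_∈? p) (allFin⁺ _)

-- Induction along the bit vector: index zero contributes the head bit, and the remaining indices
-- are `suc` of those of the tail.
length-elements : (p : Subset v) → length (elements p) ≡ ∣ p ∣
length-elements []      = refl
length-elements (s ∷ p) = by-head s
  where
  filter-suc : ∀ s xs → length (filter (_∈? (s ∷ p)) (map suc xs)) ≡ length (filter (_∈? p) xs)
  filter-suc s []       = refl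
  -- The test of `suc x` against `s ∷ p` computes to the test of `x` against `p`, so this one
  -- abstraction advances both filters.
  filter-suc s (x ∷ xs) with does (x ∈? p)
  ... | true  = cong ℕ.suc (filter-suc s xs)
  ... | false = filter-suc s xs

  length-tail : ∀ s → length (filter (_∈? (s ∷ p)) (tabulate suc)) ≡ ∣ p ∣
  length-tail s = begin
    length (filter (_∈? (s ∷ p)) (tabulate suc))
      ≡⟨ cong (length ∘ filter (_∈? (s ∷ p))) (map-tabulate id suc) ⟨
    length (filter (_∈? (s ∷ p)) (map suc (allFin _)))  ≡⟨ filter-suc s (allFin _) ⟩
    length (elements p)                                 ≡⟨ length-elements p ⟩
    ∣ p ∣                                               ∎
    where open ≡-Reasoning

  by-head : ∀ s → length (elements (s ∷ p)) ≡ ∣ s ∷ p ∣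
  by-head inside  = cong ℕ.suc (length-tail inside)
  by-head outside = length-tail outside

card-by-enumeration : {p : Subset v} {xs : List (Fin v)} → Unique xs →
                      (∀ {x} → x ∈ₛ p ⇔ x ∈ xs) → ∣ p ∣ ≡ length xs
card-by-enumeration {p = p} uxs eq =
  trans (sym (length-elements p))
        (length-cong-set (elements-unique p) uxs
          (mk⇔ (to eq ∘ to ∈-elements) (from ∈-elements ∘ from eq)))

-- The length of this list is `occurrences A x` by definition, so replication numbers can be found
-- by comparing lists of cells.
cells : Array r c v → Fin v → List (Fin r × Fin c)
cells A x = filter (λ cell → uncurry A cell ≟ x) (cartesianProduct (allFin _) (allFin _))

∈-cells : (A : Array r c v) {x : Fin v} {i : Fin r} {j : Fin c} →
          (i , j) ∈ cells A x ⇔ A i j ≡ x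
∈-cells {r} {c} A {x} = mk⇔
  (proj₂ ∘ ∈-filter⁻ P? {xs = cartesianProduct (allFin r) (allFin c)})
  (∈-filter⁺ P? (∈-cartesianProduct⁺ (∈-allFin _) (∈-allFin _)))
  where
  P? = λ cell → uncurry A cell ≟ x

cells-unique : (A : Array r c v) (x : Fin v) → Unique (cells A x)
cells-unique A x =
  filter⁺ (λ cell → uncurry A cell ≟ x) (cartesianProduct⁺ (allFin⁺ _) (allFin⁺ _))

occurrences-by-enumeration : (A : Array r c v) {x : Fin v} {ys : List (Fin r × Fin c)} →
  Unique ys → (∀ {i j} → A i j ≡ x ⇔ (i , j) ∈ ys) → occurrences A x ≡ length ys
occurrences-by-enumeration A {x} uys eq = length-cong-set (cells-unique A x) uys
  (mk⇔ (to eq ∘ to (∈-cells A)) (from (∈-cells A) ∘ from eq))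

-- Symbols of rows and columns

∈-⋃⁻ : {x : Fin v} (ps : List (Subset v)) → x ∈ₛ ⋃ ps → ∃[ p ] p ∈ ps × x ∈ₛ p
∈-⋃⁻ []       x∈⊥ = contradiction x∈⊥ ∉⊥
∈-⋃⁻ (p ∷ ps) x∈  with x∈p∪q⁻ p (⋃ ps) x∈
... | inj₁ x∈p = p , here refl , x∈p
... | inj₂ x∈⋃ with q , q∈ps , x∈q ← ∈-⋃⁻ ps x∈⋃ = q , there q∈ps , x∈q

∈-⋃⁺ : {x : Fin v} {p : Subset v} {ps : List (Subset v)} → p ∈ ps → x ∈ₛ p → x ∈ₛ ⋃ ps
∈-⋃⁺ (here refl) x∈p = x∈p∪q⁺ (inj₁ x∈p)
∈-⋃⁺ (there p∈)  x∈p = x∈p∪q⁺ (inj₂ (∈-⋃⁺ p∈ x∈p))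

∈-rowSymbols : (A : Array r c v) {i : Fin r} {x : Fin v} →
               x ∈ₛ rowSymbols A i ⇔ (∃[ j ] A i j ≡ x)
∈-rowSymbols A {i} {x} = mk⇔ forth back
  where
  forth : x ∈ₛ rowSymbols A i → ∃[ j ] A i j ≡ x
  forth x∈ with p , p∈ , x∈p ← ∈-⋃⁻ (tabulate (λ j → ⁅ A i j ⁆)) x∈
           with j , refl ← ∈-tabulate⁻ p∈ = j , sym (x∈⁅y⁆⇒x≡y _ x∈p)

  back : (∃[ j ] A i j ≡ x) → x ∈ₛ rowSymbols A i
  back (j , refl) = ∈-⋃⁺ (∈-tabulate⁺ j) (x∈⁅x⁆ _)

∈-columnSymbols : (A : Array r c v) {j : Fin c} {x : Fin v} →
                  x ∈ₛ columnSymbols A j ⇔ (∃[ i ] A i j ≡ x)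
-- `columnSymbols A j` and `rowSymbols (flip A) j` unfold to the same union.
∈-columnSymbols A = ∈-rowSymbols (flip A)

commonSymbols : Array r c v → Fin r → Fin c → Subset v
commonSymbols A i j = rowSymbols A i ∩ columnSymbols A j

∈-commonSymbols : (A : Array r c v) {i : Fin r} {j : Fin c} {x : Fin v} →
  x ∈ₛ commonSymbols A i j ⇔ ((∃[ j′ ] A i j′ ≡ x) × (∃[ i′ ] A i′ j ≡ x))
∈-commonSymbols A {i} {j} = mk⇔
  (λ x∈ → let x∈row , x∈column = x∈p∩q⁻ (rowSymbols A i) (columnSymbols A j) x∈
          in to (∈-rowSymbols A) x∈row , to (∈-columnSymbols A) x∈column)
  (λ (x∈row , x∈column) →
     x∈p∩q⁺ (from (∈-rowSymbols A) x∈row , from (∈-columnSymbols A) x∈column))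

-- Transposes

-- The conditions are symmetric in rows and columns. This turns rectangles whose columns contain
-- every symbol into rectangles whose rows do.
transpose-isAOArray : {e λrc : ℕ} {A : Array r c v} →
                      IsAOArray e λrc A → IsAOArray e λrc (flip A)
transpose-isAOArray {A = A} isAO = record
  { isRowColumnDesign = record
    { row-distinct    = column-distinct
    ; column-distinct = row-distinct
    ; replication     = λ x → trans (transposed x) (replication x)
    }
  ; adjusted = λ i j → trans (cong ∣_∣ (∩-comm (columnSymbols A i) (rowSymbols A j)))
                             (adjusted j i)
  }
  where
  open IsAOArray isAO
  open IsRowColumnDesign isRowColumnDesign

  transposed : ∀ x → occurrences (flip A) x ≡ occurrences A x
  transposed x = trans
    -- The cells are those of `A` with coordinates swapped. `swap` is an involution, so applying it
    -- again proves it injective.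
    (occurrences-by-enumeration (flip A) (map⁺ (cong swap) (cells-unique A x))
      (mk⇔ (∈-map⁺ swap ∘ from (∈-cells A))
           (λ ij∈ → swapped (∈-map⁻ swap ij∈))))
    (length-map swap (cells A x))
    where
    swapped : ∀ {i j} → (∃[ ji ] ji ∈ cells A x × (i , j) ≡ swap ji) → A j i ≡ x
    swapped (_ , ji∈ , refl) = to (∈-cells A) ji∈

-- Products

remQuot-injective : (m : ℕ) {i j : Fin (r * m)} →
                    proj₁ (remQuot {r} m i) ≡ proj₁ (remQuot {r} m j) →
                    proj₂ (remQuot {r} m i) ≡ proj₂ (remQuot {r} m j) → i ≡ j
remQuot-injective {r} m {i} {j} eq₁ eq₂ =
  trans (sym (combine-remQuot {r} m i)) (trans (cong₂ combine eq₁ eq₂) (combine-remQuot {r} m j))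

combine-injective′ : {x x′ : Fin vS} {y y′ : Fin vT} →
                     combine x y ≡ combine x′ y′ → x ≡ x′ × y ≡ y′
combine-injective′ = combine-injective _ _ _ _

-- Because every block is the same array `T`, a position in `S` and a position in `T` can be varied
-- independently. This is what makes the counts below multiplicative.
_⊗_ : Array rS cS vS → Array rT cT vT → Array (rS * rT) (cS * cT) (vS * vT)
S ⊗ T = substitute S (λ _ _ → T)

⊗-combine : (S : Array rS cS vS) (T : Array rT cT vT) → ∀ p i q j →
            (S ⊗ T) (combine p i) (combine q j) ≡ combine (S p q) (T i j)
⊗-combine {rT = rT} {cT = cT} S T p i q j = cong₂
  (λ (p′ , i′) (q′ , j′) → combine (S p′ q′) (T i′ j′))
  (remQuot-combine {k = rT} p i) (remQuot-combine {k = cT} q j)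

module _ (S : Array rS cS vS) (T : Array rT cT vT) where

  combineCells : Fin rS × Fin cS → Fin rT × Fin cT → Fin (rS * rT) × Fin (cS * cT)
  combineCells (p , q) (i , j) = combine p i , combine q j

  combineCells-injective : ∀ {k k′ l l′} → combineCells k l ≡ combineCells k′ l′ →
                           k ≡ k′ × l ≡ l′
  combineCells-injective {p , q} {p′ , q′} {i , j} {i′ , j′} eq
    with refl , refl ← combine-injective p i p′ i′ (cong proj₁ eq)
    with refl , refl ← combine-injective q j q′ j′ (cong proj₂ eq) = refl , refl

  -- By injectivity of `combine`, a cell holds `combine x y` exactly when its block holds `x` in `S`
  -- and its place within the block holds `y` in `T`.
  occurrences-⊗ : ∀ x y → occurrences (S ⊗ T) (combine x y) ≡ occurrences S x * occurrences T y
  occurrences-⊗ x y = trans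
    (occurrences-by-enumeration (S ⊗ T)
      (cartesianProductWith⁺ combineCells combineCells-injective
        (cells-unique S x) (cells-unique T y))
      (mk⇔ forth back))
    (length-cartesianProductWith combineCells (cells S x) (cells T y))
    where
    forth : ∀ {i j} → (S ⊗ T) i j ≡ combine x y →
            (i , j) ∈ cartesianProductWith combineCells (cells S x) (cells T y)
    forth {i} {j} eq with eqS , eqT ← combine-injective′ eq =
      -- The enumeration contains only cells of the form `combineCells k l`; `combine-remQuot`
      -- brings an arbitrary cell into that form.
      subst (_∈ cartesianProductWith combineCells (cells S x) (cells T y))
        (cong₂ _,_ (combine-remQuot {rS} rT i) (combine-remQuot {cS} cT j))
        (∈-cartesianProductWith⁺ combineCells (from (∈-cells S) eqS) (from (∈-cells T) eqT))

    back : ∀ {i j} → (i , j) ∈ cartesianProductWith combineCells (cells S x) (cells T y) →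
           (S ⊗ T) i j ≡ combine x y
    back ij∈
      with (p , q) , (i , j) , pq∈ , ij∈T , refl ←
             ∈-cartesianProductWith⁻ combineCells (cells S x) (cells T y) ij∈ =
      trans (⊗-combine S T p i q j)
            (cong₂ combine (to (∈-cells S) pq∈) (to (∈-cells T) ij∈T))

  -- The symbols of row `i` are all `combine x y` with `x` in row `p` of `S` and `y` in row `i′` of
  -- `T`, and likewise for columns. The intersection is therefore again a product set.
  card-commonSymbols-⊗ : ∀ i j →
    let p , i′ = remQuot {rS} rT i ; q , j′ = remQuot {cS} cT j in
    ∣ commonSymbols (S ⊗ T) i j ∣ ≡ ∣ commonSymbols S p q ∣ * ∣ commonSymbols T i′ j′ ∣
  card-commonSymbols-⊗ i j = begin
    ∣ commonSymbols (S ⊗ T) i j ∣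
      ≡⟨ card-by-enumeration
           (cartesianProductWith⁺ combine combine-injective′
             (elements-unique common-S) (elements-unique common-T))
           (mk⇔ forth back) ⟩
    length (cartesianProductWith combine (elements common-S) (elements common-T))
      ≡⟨ length-cartesianProductWith combine (elements common-S) (elements common-T) ⟩
    length (elements common-S) * length (elements common-T)
      ≡⟨ cong₂ _*_ (length-elements common-S) (length-elements common-T) ⟩
    ∣ common-S ∣ * ∣ common-T ∣  ∎
    where
    open ≡-Reasoning

    p  = proj₁ (remQuot {rS} rT i)
    i′ = proj₂ (remQuot {rS} rT i)
    q  = proj₁ (remQuot {cS} cT j)
    j′ = proj₂ (remQuot {cS} cT j)

    common-S = commonSymbols S p q
    common-T = commonSymbols T i′ j′

    forth : ∀ {z} → z ∈ₛ commonSymbols (S ⊗ T) i j →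
            z ∈ cartesianProductWith combine (elements common-S) (elements common-T)
    forth z∈
      -- The row occurrence fixes `z` as the entry in column `k`; the column occurrence `eq` then
      -- splits into an equation in `S` and one in `T`.
      with (k , refl) , (l , eq) ← to (∈-commonSymbols (S ⊗ T)) z∈
      with eqS , eqT ← combine-injective′ eq =
      ∈-cartesianProductWith⁺ combine
        (from ∈-elements (from (∈-commonSymbols S) ((_ , refl) , (_ , eqS))))
        (from ∈-elements (from (∈-commonSymbols T) ((_ , refl) , (_ , eqT))))

    back : ∀ {z} → z ∈ cartesianProductWith combine (elements common-S) (elements common-T) →
           z ∈ₛ commonSymbols (S ⊗ T) i j
    back z∈
      with x , y , x∈ , y∈ , refl ←
             ∈-cartesianProductWith⁻ combine (elements common-S) (elements common-T) z∈
      with (q₁ , eq₁) , (p₁ , eq₂) ← to (∈-commonSymbols S) (to ∈-elements x∈)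
      with (j₁ , eq₃) , (i₁ , eq₄) ← to (∈-commonSymbols T) (to ∈-elements y∈) =
      from (∈-commonSymbols (S ⊗ T))
        -- The occurrences in `S` and in `T` combine into one in row `i`, and below into one in
        -- column `j`. The fixed index is first rewritten as a `combine` so that `⊗-combine`
        -- applies.
        ( (combine q₁ j₁ , trans (cong (λ k → (S ⊗ T) k (combine q₁ j₁))
                                       (sym (combine-remQuot {rS} rT i)))
                           (trans (⊗-combine S T p i′ q₁ j₁) (cong₂ combine eq₁ eq₃)))
        , (combine p₁ i₁ , trans (cong (λ k → (S ⊗ T) (combine p₁ i₁) k)
                                       (sym (combine-remQuot {cS} cT j)))
                           (trans (⊗-combine S T p₁ i₁ q j′) (cong₂ combine eq₂ eq₄))) )

⊗-isAOArray : {eS eT λS λT : ℕ} {S : Array rS cS vS} {T : Array rT cT vT} →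
              IsAOArray eS λS S → IsAOArray eT λT T →
              IsAOArray (eS * eT) (λS * λT) (S ⊗ T)
⊗-isAOArray {rS} {cS} {vS} {rT} {cT} {vT} {eS} {eT} {S = S} {T} isS isT = record
  { isRowColumnDesign = record
    { row-distinct    = λ i eq → let eqS , eqT = combine-injective′ eq in
        remQuot-injective {cS} cT (DS.row-distinct _ eqS) (DT.row-distinct _ eqT)
    ; column-distinct = λ j eq → let eqS , eqT = combine-injective′ eq in
        remQuot-injective {rS} rT (DS.column-distinct _ eqS) (DT.column-distinct _ eqT)
    ; replication     = replication
    }
  ; adjusted = λ i j → trans (card-commonSymbols-⊗ S T i j)
                             (cong₂ _*_ (MS.adjusted _ _) (MT.adjusted _ _))
  }
  where
  module MS = IsAOArray isS
  module MT = IsAOArray isT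
  module DS = IsRowColumnDesign MS.isRowColumnDesign
  module DT = IsRowColumnDesign MT.isRowColumnDesign

  replication : ∀ z → occurrences (S ⊗ T) z ≡ eS * eT
  replication z = begin
    occurrences (S ⊗ T) z              ≡⟨ cong (occurrences (S ⊗ T)) (combine-remQuot {vS} vT z) ⟨
    occurrences (S ⊗ T) (combine x y)  ≡⟨ occurrences-⊗ S T x y ⟩
    occurrences S x * occurrences T y  ≡⟨ cong₂ _*_ (DS.replication x) (DT.replication y) ⟩
    eS * eT                            ∎
    where
    open ≡-Reasoning
    x = proj₁ (remQuot {vS} vT z)
    y = proj₂ (remQuot {vS} vT z)

⊗-isProduct : (S : Array rS cS vS) (T : Array rT cT vT) → IsProduct S T (S ⊗ T)
⊗-isProduct S T = record
  { rows     = refl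
  ; columns  = refl
  ; symbols  = refl
  ; copy     = λ _ _ → T
  ; isotopic = λ _ _ → Permutation.id , Permutation.id , Permutation.id , λ _ _ → refl
  -- A `cast` along `refl` is only propositionally the identity on a variable index.
  ; agrees   = λ i j → trans (cast-is-id refl _)
                 (sym (cong₂ (S ⊗ T) (cast-is-id refl i) (cast-is-id refl j)))
  }

-- Cyclic Latin rectangles

[m%n+o]%n≡[m+o]%n : ∀ m o n .{{_ : NonZero n}} → (m % n + o) % n ≡ (m + o) % n
[m%n+o]%n≡[m+o]%n m o n = begin
  (m % n + o) % n          ≡⟨ %-distribˡ-+ (m % n) o n ⟩
  (m % n % n + o % n) % n  ≡⟨ cong (λ t → (t + o % n) % n) (m%n%n≡m%n m n) ⟩
  (m % n + o % n) % n      ≡⟨ %-distribˡ-+ m o n ⟨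
  (m + o) % n              ∎
  where open ≡-Reasoning

module _ {n : ℕ} where

  -- Addition and subtraction modulo `n`. The argument `i` itself witnesses that `n` is nonzero, and
  -- `n ∸ toℕ j` loses nothing to truncation since `toℕ j` is below `n`.
  _⊕_ _⊖_ : Fin n → Fin n → Fin n
  i ⊕ j = ((toℕ i + toℕ j) mod n) {{nonZeroIndex i}}
  i ⊖ j = ((toℕ i + (n ∸ toℕ j)) mod n) {{nonZeroIndex i}}

  ⊕-comm : ∀ i j → i ⊕ j ≡ j ⊕ i
  ⊕-comm i j = cong (λ t → (t mod n) {{nonZeroIndex i}}) (+-comm (toℕ i) (toℕ j))

  -- Two shifts adding up to `n` undo each other. Both cancellation laws are instances, with `toℕ j`
  -- and `n ∸ toℕ j` in either order.
  shift-by-n : (i : Fin n) (k l : ℕ) → k + l ≡ n → let instance _ = nonZeroIndex i in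
            (toℕ ((toℕ i + k) mod n) + l) mod n ≡ i
  shift-by-n i k l k+l≡n = toℕ-injective (begin
    toℕ ((toℕ ((toℕ i + k) mod n) + l) mod n)  ≡⟨ toℕ-fromℕ< _ ⟩
    (toℕ ((toℕ i + k) mod n) + l) % n          ≡⟨ cong (λ t → (t + l) % n) (toℕ-fromℕ< _) ⟩
    ((toℕ i + k) % n + l) % n                  ≡⟨ [m%n+o]%n≡[m+o]%n (toℕ i + k) l n ⟩
    (toℕ i + k + l) % n                        ≡⟨ cong (_% n) (+-assoc (toℕ i) k l) ⟩
    (toℕ i + (k + l)) % n                      ≡⟨ cong (λ t → (toℕ i + t) % n) k+l≡n ⟩
    (toℕ i + n) % n                            ≡⟨ [m+n]%n≡m%n (toℕ i) n ⟩
    toℕ i % n                                  ≡⟨ m<n⇒m%n≡m (toℕ<n i) ⟩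
    toℕ i                                      ∎)
    where
    open ≡-Reasoning
    instance _ = nonZeroIndex i

  ⊕-⊖ : ∀ i j → (i ⊕ j) ⊖ j ≡ i
  ⊕-⊖ i j = shift-by-n i (toℕ j) (n ∸ toℕ j) (m+[n∸m]≡n (toℕ≤n j))

  ⊖-⊕ : ∀ i j → (i ⊖ j) ⊕ j ≡ i
  ⊖-⊕ i j = shift-by-n i (n ∸ toℕ j) (toℕ j)
    (trans (+-comm (n ∸ toℕ j) (toℕ j)) (m+[n∸m]≡n (toℕ≤n j)))

  ⊕-cancelʳ : ∀ j → Injective _≡_ _≡_ (_⊕ j)
  ⊕-cancelʳ j {i} {i′} eq = trans (sym (⊕-⊖ i j)) (trans (cong (_⊖ j) eq) (⊕-⊖ i′ j))

  ⊕-cancelˡ : ∀ i → Injective _≡_ _≡_ (i ⊕_)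
  ⊕-cancelˡ i {j} {j′} eq = ⊕-cancelʳ i (trans (⊕-comm j i) (trans eq (⊕-comm i j′)))

module _ {n k : ℕ} (k≤n : k ≤ n) where

  -- The first `k` columns of the addition table of the integers modulo `n`. Each column is a
  -- permutation of the symbols.
  cyclic : Array n k n
  cyclic i j = i ⊕ inject≤ j k≤n

  cyclic-row-injective : ∀ i → Injective _≡_ _≡_ (cyclic i)
  cyclic-row-injective i = inject≤-injective k≤n k≤n _ _ ∘ ⊕-cancelˡ i

  cyclic-isAOArray : IsAOArray k k cyclic
  cyclic-isAOArray = record
    { isRowColumnDesign = record
      { row-distinct    = cyclic-row-injective
      ; column-distinct = λ j → ⊕-cancelʳ (inject≤ j k≤n)
      ; replication     = replication
      }
    ; adjusted = adjusted
    }
    where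
    -- The one cell of column `j` that holds `x`. Listing these by column gives `k` occurrences,
    -- distinct because their second coordinates are.
    cell : Fin n → Fin k → Fin n × Fin k
    cell x j = x ⊖ inject≤ j k≤n , j

    replication : ∀ x → occurrences cyclic x ≡ k
    replication x = trans
      (occurrences-by-enumeration cyclic (map⁺ {f = cell x} (cong proj₂) (allFin⁺ k))
        (mk⇔ forth back))
      (trans (length-map (cell x) (allFin k)) (length-tabulate id))
      where
      forth : ∀ {i j} → cyclic i j ≡ x → (i , j) ∈ map (cell x) (allFin k)
      forth {i} {j} refl =
        subst (λ i′ → (i′ , j) ∈ map (cell x) (allFin k)) (⊕-⊖ i (inject≤ j k≤n))
          (∈-map⁺ (cell x) (∈-allFin j))

      back : ∀ {i j} → (i , j) ∈ map (cell x) (allFin k) → cyclic i j ≡ x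
      back ij∈ with j , _ , refl ← ∈-map⁻ (cell x) ij∈ = ⊖-⊕ x (inject≤ j k≤n)

    -- Every column contains all n symbols, so only the row matters.
    adjusted : ∀ i j → ∣ commonSymbols cyclic i j ∣ ≡ k
    adjusted i j = trans
      (card-by-enumeration (map⁺ (cyclic-row-injective i) (allFin⁺ k)) (mk⇔ forth back))
      (trans (length-map (cyclic i) (allFin k)) (length-tabulate id))
      where
      forth : ∀ {x} → x ∈ₛ commonSymbols cyclic i j → x ∈ map (cyclic i) (allFin k)
      forth x∈ with (j′ , refl) , _ ← to (∈-commonSymbols cyclic) x∈ =
        ∈-map⁺ (cyclic i) (∈-allFin j′)

      back : ∀ {x} → x ∈ map (cyclic i) (allFin k) → x ∈ₛ commonSymbols cyclic i j
      back {x} x∈ with j′ , _ , eq ← ∈-map⁻ (cyclic i) x∈ =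
        from (∈-commonSymbols cyclic)
          ((j′ , sym eq) , (x ⊖ inject≤ j k≤n , ⊖-⊕ x (inject≤ j k≤n)))

-- Arithmetic

factorise : ∀ {v e r c} .{{_ : NonZero v}} → v * e ≡ r * c → r ≤ v → c ≤ v →
            ∃[ g ] ∃[ k ] ∃[ a ] ∃[ b ]
            v ≡ g * b × e ≡ k * a × r ≡ g * a × c ≡ k * b × k ≤ g × a ≤ b
factorise {v} {e} {r} {c} ve≡rc r≤v c≤v =
  g , k , a , b , v≡g*b , e≡k*a , r≡g*a , c≡k*b , k≤g , a≤b
  where
  open ≡-Reasoning

  g = gcd v r

  instance
    g≢0 : NonZero g
    g≢0 = ≢-nonZero (gcd[m,n]≢0 v r (inj₁ (≢-nonZero⁻¹ v)))

  a = r / g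
  b = v / g
  b⊥a = coprime-/gcd v r

  v≡g*b : v ≡ g * b
  v≡g*b = trans (sym (m/n*n≡m (gcd[m,n]∣m v r))) (*-comm b g)

  r≡g*a : r ≡ g * a
  r≡g*a = trans (sym (m/n*n≡m (gcd[m,n]∣n v r))) (*-comm a g)

  instance
    b≢0 : NonZero b
    -- A factor of the nonzero `v`; this permits cancelling `b` in `e≡k*a` and `k≤g`.
    b≢0 = m*n≢0⇒n≢0 g {{subst NonZero v≡g*b it}}

  be≡ac : b * e ≡ a * c
  be≡ac = *-cancelˡ-≡ (b * e) (a * c) g (begin
    g * (b * e)  ≡⟨ *-assoc g b e ⟨
    g * b * e    ≡⟨ cong (_* e) v≡g*b ⟨
    v * e        ≡⟨ ve≡rc ⟩
    r * c        ≡⟨ cong (_* c) r≡g*a ⟩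
    g * a * c    ≡⟨ *-assoc g a c ⟩
    g * (a * c)  ∎)

  ac≡eb : a * c ≡ e * b
  ac≡eb = trans (sym be≡ac) (*-comm b e)

  b∣c : b ∣ c
  -- `b` divides `a * c` with quotient `e`, and it shares no factor with `a`.
  b∣c = coprime-divisor b⊥a (divides e ac≡eb)

  k = quotient b∣c

  c≡k*b : c ≡ k * b
  c≡k*b = _∣_.equality b∣c

  e≡k*a : e ≡ k * a
  e≡k*a = *-cancelˡ-≡ e (k * a) b (begin
    b * e        ≡⟨ be≡ac ⟩
    a * c        ≡⟨ cong (a *_) c≡k*b ⟩
    a * (k * b)  ≡⟨ *-assoc a k b ⟨
    a * k * b    ≡⟨ *-comm (a * k) b ⟩
    b * (a * k)  ≡⟨ cong (b *_) (*-comm a k) ⟩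
    b * (k * a)  ∎)

  k≤g : k ≤ g
  k≤g = *-cancelʳ-≤ k g b (subst₂ _≤_ c≡k*b v≡g*b c≤v)

  a≤b : a ≤ b
  a≤b = *-cancelˡ-≤ g (subst₂ _≤_ r≡g*a v≡g*b r≤v)

-- Assembling the array from two Latin rectangles

proposition4p5 : (v e r c : ℕ) → 0 < v → 0 < e → 1 < r → 1 < c →
    v * e ≡ r * c → r ⊔ c < v → 2 * v ≤ r * c →
    (∃[ vS ] ∃[ eS ] ∃[ λS ] ∃[ rS ] ∃[ cS ]
    ∃[ vT ] ∃[ eT ] ∃[ λT ] ∃[ a ] ∃[ b ]
    Σ[ S ∈ AOArray vS eS λS rS cS ] Σ[ T ∈ AOArray vT eT λT a b ]
    ∃[ λrc ] Σ[ A ∈ AOArray v e λrc r c ]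
    IsProduct (AOArray.array S) (AOArray.array T) (AOArray.array A))
    × (∃[ λrc ] AOArray v e λrc r c)
proposition4p5 v e r c 0<v _ _ _ ve≡rc r⊔c<v _
  -- Matching on `refl` replaces the four parameters by their factorisations, so that the product
  -- has the required type without transport.
  with g , k , a , b , refl , refl , refl , refl , k≤g , a≤b ←
         factorise {{>-nonZero 0<v}} ve≡rc (<⇒≤ (m⊔n<o⇒m<o r c r⊔c<v))
                   (<⇒≤ (m⊔n<o⇒n<o r c r⊔c<v)) =
  (_ , _ , _ , _ , _ , _ , _ , _ , _ , _ , S , T , _ , A ,
   ⊗-isProduct (AOArray.array S) (AOArray.array T)) , _ , A
  where
  S : AOArray g k k g k
  S = record { isAOArray = cyclic-isAOArray k≤g }

  -- The transpose is needed because `T` has at most as many rows as columns, whereas `cyclic` has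
  -- at least as many. Each row of `T` contains all `b` symbols, so a row and a column share the `a`
  -- symbols of the column.
  T : AOArray b a a a b
  T = record { isAOArray = transpose-isAOArray (cyclic-isAOArray a≤b) }

  -- In both ingredients the intersection number equals the replication number, so the resulting
  -- `λrc` is `k * a`, which is `e`.
  A : AOArray (g * b) (k * a) (k * a) (g * a) (k * b)
  A = record { isAOArray = ⊗-isAOArray (AOArray.isAOArray S) (AOArray.isAOArray T) }
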